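{- Let $N_1,N_2$ be positive integers, $N=N_1N_2$, let $k\ge 2$ be an integer, and let $\chi_1,\chi_2$ be quadratic Dirichlet characters modulo $N_1,N_2$ respectively. For infinitely many integers $n$, we have $\sigma_{\chi_1,\chi_2}^{k-1}(n)>0$. Similarly, we have $\sigma_{\chi_1,\chi_2}^{k-1}(n)<0$ for infinitely many $n$. In fact, we have $$\lim_{x\to\infty}\frac{1}{x}\cdot\#\{n\le x:(n,N)=1,\ \sigma_{\chi_1,\chi_2}^{k-1}(n)>0\}=\frac12$$ and $$\lim_{x\to\infty}\frac{1}{x}\cdot\#\{n\le x:(n,N)=1,\ \sigma_{\chi_1,\chi_2}^{k-1}(n)<0\}=\frac12.$$
   Context: For Dirichlet characters $\chi_1,\chi_2$ modulo $N_1,N_2$ and an integer $k\ge 2$, define for positive integers $n$ $$\sigma_{\chi_1,\chi_2}^{k-1}(n)=\sum_{d\mid n}\chi_1(n/d)\chi_2(d)d^{k-1}.$$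
   Formalization: The two limits are normalised by #{n ≤ x : (n,N)=1} instead of x; as printed they are false, since both disjoint sets lie in the integers prime to N, of density φ(N)/N < 1 (e.g. N₁=N₂=3). -}

module Defs where

open import Data.Integer.Base as ℤ using (ℤ; +_; 0ℤ; 1ℤ)
open import Data.Integer.Coprimality using (Coprime)
open import Data.List.Base using (List; foldr; map; filter; upTo; length)
open import Data.Nat.Base using (ℕ; zero; suc; _<_; _≤_; _∸_; _/_)
open import Data.Nat.Divisibility using (_∣?_)
open import Data.Product.Base using (_×_; ∃-syntax)
open import Data.Rational.Base as ℚ using (ℚ; 0ℚ)
open import Function.Bundles using (_⇔_)
open import Level using (Level)
open import Relation.Binary.PropositionalEquality.Core using (_≡_; _≢_)
open import Relation.Nullary.Negation.Core using (¬_)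
open import Relation.Unary using (Pred; Decidable)

private variable
  ℓ : Level

-- Dirichlet characters modulo N with values in ℤ. A complex Dirichlet
-- character of order two takes only the values 0, 1 and -1, so no quadratic
-- character is lost. (The law χ 1 ≡ 1 follows from the last two fields.)
record DirichletCharacter (N : ℕ) : Set where
  field
    χ              : ℤ → ℤ
    periodic       : ∀ a → χ (a ℤ.+ + N) ≡ χ a
    multiplicative : ∀ a b → χ (a ℤ.* b) ≡ χ a ℤ.* χ b
    support        : ∀ a → χ a ≢ 0ℤ ⇔ Coprime a (+ N)

open DirichletCharacter public using (χ)

-- Agreement with the principal character modulo N. For a function vanishing
-- off the integers prime to N only these values matter.
IsPrincipal : ℕ → (ℤ → ℤ) → Set
IsPrincipal N f = ∀ a → Coprime a (+ N) → f a ≡ 1ℤ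

-- Order exactly two in the group of characters modulo N.
Quadratic : ∀ {N} → DirichletCharacter N → Set
Quadratic {N} ψ =
  ¬ IsPrincipal N (χ ψ) × IsPrincipal N (λ a → χ ψ a ℤ.* χ ψ a)

sumℤ : List ℤ → ℤ
sumℤ = foldr ℤ._+_ 0ℤ

-- σ ψ₁ ψ₂ m n = ∑_{d ∣ n} ψ₁(n/d) ψ₂(d) d^m, where the divisor d is suc i with
-- i < n.
σ : ∀ {N₁ N₂} → DirichletCharacter N₁ → DirichletCharacter N₂ → ℕ → ℕ → ℤ
σ ψ₁ ψ₂ m n = sumℤ (map term (filter (λ i → suc i ∣? n) (upTo n)))
  where
  term : ℕ → ℤ
  term i = χ ψ₁ (+ (n / suc i)) ℤ.* χ ψ₂ (+ suc i) ℤ.* (+ suc i) ℤ.^ m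

InfinitelyMany : Pred ℕ ℓ → Set ℓ
InfinitelyMany P = ∀ m → ∃[ n ] m < n × P n

-- #{ 1 ≤ n ≤ x : P n }
count : {P : Pred ℕ ℓ} → Decidable P → ℕ → ℕ
count P? x = length (filter P? (map suc (upTo x)))

-- The quotient of naturals, with the junk value 0 for a zero denominator.
_÷_ : ℕ → ℕ → ℚ
p ÷ zero  = 0ℚ
p ÷ suc q = + p ℚ./ suc q

_TendsTo_ : (ℕ → ℚ) → ℚ → Set
f TendsTo l =
  ∀ ε → 0ℚ ℚ.< ε → ∃[ X ] (∀ x → X ≤ x → ℚ.∣ f x ℚ.- l ∣ ℚ.< ε)

-- P has density l among the n satisfying Q:
--
--   lim_{x→∞} #{ n ≤ x : Q n, P n } / #{ n ≤ x : Q n } = l.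
--
-- Both counts depend only on ⌊x⌋, so natural x suffice. The normalisation is
-- by the count for Q, not by x: when Q is "prime to N" with N > 1, it holds
-- for a proportion φ(N)/N < 1 of all n, so two disjoint sets of such n
-- cannot both have density 1/2 among all positive integers.
HasDensity : ∀ {ℓ′} {Q : Pred ℕ ℓ} {P : Pred ℕ ℓ′} →
             Decidable Q → Decidable P → ℚ → Set
HasDensity Q? P? l = (λ x → count Q∩P? x ÷ count Q? x) TendsTo l
  where
  open import Relation.Unary.Properties using (_∩?_)
  Q∩P? = Q? ∩? P?

{-# OPTIONS --safe #-}

-- For n prime to N = N₁N₂ the sign of σ(n) is χ₂(n). Indeed, χ₁(n/d) = χ₁(n) χ₁(d), so
-- σ(n) = χ₁(n) G(n) with G(n) = ∑_{d∣n} g(d) and g(d) = χ₁χ₂(d) d^{k−1}. Splitting the divisors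
-- of p^{a+1} m, where p ∤ m, according to divisibility by p gives
-- G(p^{a+1} m) = g(p) G(p^a m) + G(m), and |g(p)| ≥ 2, so the first term dominates and
-- χ₁χ₂(n) G(n) > 0 by induction.
-- On the other hand t = χ₁²χ₂ is a character mod N taking the value −1, so its sum over a
-- period is 0 and its partial sums, i.e. the differences of the numbers of n ≤ x prime to N
-- with χ₂(n) = 1 and with χ₂(n) = −1, are bounded.
module Submission where

open import Defs
open import Data.Integer.Base using (0ℤ) renaming (_<_ to _<ℤ_)
open import Data.Integer.Properties using () renaming (_<?_ to _<ℤ?_)
open import Data.Nat.Base using (ℕ; NonZero; _≤_; _*_; _∸_)
open import Data.Nat.Coprimality using (Coprime; coprime?)
open import Data.Product.Base using (_×_)
open import Data.Rational.Base using (½)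

open import Data.Empty using (⊥-elim)
open import Data.Integer.Base as ℤ using (ℤ; +_; 1ℤ; -1ℤ; ∣_∣)
import Data.Integer.DivMod as ℤ
import Data.Integer.Properties as ℤ
import Data.Integer.Tactic.RingSolver as ℤ
open import Data.List.Base
  using (List; []; _∷_; _++_; _∷ʳ_; map; filter; upTo; applyUpTo; length)
open import Data.List.Membership.Propositional using (_∈_)
open import Data.List.Membership.Propositional.Properties
  using (∈-map⁺; ∈-map⁻; ∈-filter⁺; ∈-filter⁻; ∈-upTo⁺; ∈-upTo⁻; ∈-applyUpTo⁺; ∈-applyUpTo⁻)
open import Data.List.Membership.Propositional.Properties.WithK using (unique∧set⇒bag)
open import Data.List.Properties
  using (map-∘; map-cong; map-cong-local; map-++; map-upTo; upTo-∷ʳ; length-++;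
         filter-++; filter-accept; filter-reject)
open import Data.List.Relation.Binary.BagAndSetEquality using (∼bag⇒↭)
open import Data.List.Relation.Binary.Permutation.Propositional using (_↭_; ↭⇒↭ₛ)
open import Data.List.Relation.Binary.Permutation.Propositional.Properties using (map⁺)
open import Data.List.Relation.Binary.Permutation.Setoid.Properties using (foldr-commMonoid)
open import Data.List.Relation.Unary.All as All using (All; []; _∷_)
open import Data.List.Relation.Unary.All.Properties using (all-filter)
open import Data.List.Relation.Unary.Unique.Propositional using (Unique)
import Data.List.Relation.Unary.Unique.Propositional.Properties as Unique
open import Data.Nat.Base
open import Data.Nat.Coprimality as Coprimality using (coprime-divisor)
open import Data.Nat.Divisibility
open import Data.Nat.DivMod
open import Data.Nat.GCD using (module Bézout)
open import Data.Nat.Induction using (<-rec)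
open import Data.Nat.ListAction using (product)
open import Data.Nat.Primality
  using (Prime; prime⇒nonZero; prime⇒nonTrivial; prime⇒irreducible; euclidsLemma; ¬prime[1])
open import Data.Nat.Primality.Factorisation using (factorise)
open import Data.Nat.Properties
import Data.Nat.Tactic.RingSolver as ℕ
open import Data.Product.Base using (_,_; ∃-syntax; proj₁; proj₂)
open import Data.Rational.Base as ℚ using (mkℚ; toℚᵘ)
import Data.Rational.Properties as ℚ
open import Data.Rational.Unnormalised.Base as ℚᵘ using (ℚᵘ; mkℚᵘ; *<*)
import Data.Rational.Unnormalised.Properties as ℚᵘ
open import Data.Sum.Base using (_⊎_; inj₁; inj₂; [_,_]′)
open import Function.Base using (_∘_)
open import Function.Bundles using (mk⇔; Equivalence)
open import Level using (Level)
open import Relation.Binary.PropositionalEquality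
open import Relation.Nullary using (¬_; yes; no; contradiction)
open import Relation.Nullary.Decidable using (_×-dec_)
open import Relation.Unary using (Pred; Decidable)
open import Relation.Unary.Properties using (∁?; _∩?_)

private variable
  ℓ ℓ′ : Level
  N a b d m n p : ℕ
  g : ℕ → ℤ

-- The sign of divisor sums

-- Membership in a duplicate-free list has at most one proof, so equality as sets is already
-- equality as bags. Every reindexing of a sum below, over divisors or over residues, goes through
-- this.
∈-≐⇒↭ : {A : Set} {xs ys : List A} → Unique xs → Unique ys →
        (∀ {x} → x ∈ xs → x ∈ ys) → (∀ {x} → x ∈ ys → x ∈ xs) → xs ↭ ys
∈-≐⇒↭ !xs !ys xs⊆ys ys⊆xs = ∼bag⇒↭ (unique∧set⇒bag !xs !ys (mk⇔ xs⊆ys ys⊆xs))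

sumℤ-↭ : {xs ys : List ℤ} → xs ↭ ys → sumℤ xs ≡ sumℤ ys
sumℤ-↭ xs↭ys = foldr-commMonoid (setoid ℤ) ℤ.+-0-isCommutativeMonoid (↭⇒↭ₛ xs↭ys)

sumℤ-map-*ˡ : ∀ {A : Set} c (f : A → ℤ) xs → sumℤ (map (λ x → c ℤ.* f x) xs) ≡ c ℤ.* sumℤ (map f xs)
sumℤ-map-*ˡ c f []       = sym (ℤ.*-zeroʳ c)
sumℤ-map-*ˡ c f (x ∷ xs) = trans (cong (ℤ._+_ (c ℤ.* f x)) (sumℤ-map-*ˡ c f xs))
  (sym (ℤ.*-distribˡ-+ c (f x) (sumℤ (map f xs))))

sumℤ-partition : {A : Set} {P : Pred A ℓ} (P? : Decidable P) (f : A → ℤ) (xs : List A) →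
                 sumℤ (map f xs) ≡ sumℤ (map f (filter P? xs)) ℤ.+ sumℤ (map f (filter (∁? P?) xs))
sumℤ-partition P? f [] = refl
sumℤ-partition P? f (x ∷ xs) with ih ← sumℤ-partition P? f xs | P? x
... | yes _ = trans (cong (ℤ._+_ (f x)) ih) (sym (ℤ.+-assoc (f x) _ _))
... | no  _ = trans (cong (ℤ._+_ (f x)) ih) (shift (f x) (sumℤ (map f (filter P? xs))) _)
  where
  shift : ∀ x y z → x ℤ.+ (y ℤ.+ z) ≡ y ℤ.+ (x ℤ.+ z)
  shift = ℤ.solve-∀

-- The filtered list is the one inside `σ`; with `suc` mapped over it, `map-∘` turns the sum in `σ`
-- into a `divisorSum`.
divisors : ℕ → List ℕ
divisors n = map suc (filter (λ i → suc i ∣? n) (upTo n))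

∈-divisors⁺ : .{{NonZero n}} → d ∣ n → d ∈ divisors n
∈-divisors⁺ {n} {zero}  0∣n = contradiction (0∣⇒≡0 0∣n) (≢-nonZero⁻¹ n)
∈-divisors⁺ {n} {suc i} d∣n = ∈-map⁺ suc (∈-filter⁺ (λ i → suc i ∣? n) (∈-upTo⁺ (∣⇒≤ d∣n)) d∣n)

∈-divisors⁻ : d ∈ divisors n → d ∣ n
∈-divisors⁻ {n = n} d∈ with ∈-map⁻ suc d∈
... | i , i∈ , refl = proj₂ (∈-filter⁻ (λ i → suc i ∣? n) {xs = upTo n} i∈)

divisors-unique : ∀ n → Unique (divisors n)
divisors-unique n = Unique.map⁺ suc-injective (Unique.filter⁺ (λ i → suc i ∣? n) (Unique.upTo⁺ n))

divisorSum : (ℕ → ℤ) → ℕ → ℤ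
divisorSum g n = sumℤ (map g (divisors n))

Multiplicative : (ℕ → ℤ) → Set
Multiplicative f = ∀ a b → f (a * b) ≡ f a ℤ.* f b

coprime-∣ˡ : a ∣ m → Coprime m n → Coprime a n
coprime-∣ˡ a∣m c (d∣a , d∣n) = c (∣-trans d∣a a∣m , d∣n)

coprime-* : Coprime a m → Coprime a n → Coprime a (m * n)
coprime-* c₁ c₂ (d∣a , d∣mn) = c₂ (d∣a , coprime-divisor (coprime-∣ˡ d∣a c₁) d∣mn)

coprime-^ : Coprime a p → ∀ k → Coprime a (p ^ k)
coprime-^ c zero    = Coprimality.sym (Coprimality.1-coprimeTo _)
coprime-^ c (suc k) = coprime-* c (coprime-^ c k)

prime∤⇒coprime : Prime p → ¬ p ∣ n → Coprime n p
prime∤⇒coprime pr p∤n (d∣n , d∣p) with prime⇒irreducible pr d∣p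
... | inj₁ d≡1  = d≡1
... | inj₂ refl = contradiction d∣n p∤n

module _ (g-* : Multiplicative g) (pr : Prime p) where
  private instance
    p≢0 : NonZero p
    p≢0 = prime⇒nonZero pr

  -- The divisors that are multiples of `p` are the numbers p e with e a divisor of p^a m; the
  -- others are prime to p^(a+1) and hence divide `m`. Complete multiplicativity takes `g p` out of
  -- g(p e) even when `p` divides e.
  divisorSum-prime-power : ∀ a m .{{_ : NonZero m}} → ¬ p ∣ m →
    divisorSum g (p ^ suc a * m) ≡ g p ℤ.* divisorSum g (p ^ a * m) ℤ.+ divisorSum g m
  divisorSum-prime-power a m p∤m = begin
    sumℤ (map g (divisors n₁))
      ≡⟨ sumℤ-partition (p ∣?_) g (divisors n₁) ⟩
    sumℤ (map g (filter (p ∣?_) (divisors n₁))) ℤ.+ sumℤ (map g (filter (∁? (p ∣?_)) (divisors n₁)))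
      ≡⟨ cong₂ ℤ._+_ (sumℤ-↭ (map⁺ g p∣-part)) (sumℤ-↭ (map⁺ g p∤-part)) ⟩
    sumℤ (map g (map (p *_) (divisors n₀))) ℤ.+ divisorSum g m
      ≡⟨ cong (λ xs → sumℤ xs ℤ.+ divisorSum g m)
           (trans (sym (map-∘ (divisors n₀))) (map-cong (g-* p) (divisors n₀))) ⟩
    sumℤ (map (λ d → g p ℤ.* g d) (divisors n₀)) ℤ.+ divisorSum g m
      ≡⟨ cong (ℤ._+ divisorSum g m) (sumℤ-map-*ˡ (g p) g (divisors n₀)) ⟩
    g p ℤ.* divisorSum g n₀ ℤ.+ divisorSum g m ∎
    where
    open ≡-Reasoning
    n₀  = p ^ a * m
    n₁ = p ^ suc a * m
    instance
      n₀≢0 : NonZero n₀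
      n₀≢0 = m*n≢0 (p ^ a) m {{m^n≢0 p a}}
      n₁≢0 : NonZero n₁
      n₁≢0 = m*n≢0 (p ^ suc a) m {{m^n≢0 p (suc a)}}

    n₁≡pn₀ : n₁ ≡ p * n₀
    n₁≡pn₀ = *-assoc p (p ^ a) m

    p∣-part : filter (p ∣?_) (divisors n₁) ↭ map (p *_) (divisors n₀)
    p∣-part = ∈-≐⇒↭ (Unique.filter⁺ (p ∣?_) (divisors-unique n₁))
                    (Unique.map⁺ (*-cancelˡ-≡ _ _ p) (divisors-unique n₀)) to from
      where
      to : ∀ {d} → d ∈ filter (p ∣?_) (divisors n₁) → d ∈ map (p *_) (divisors n₀)
      to d∈ with ∈-filter⁻ (p ∣?_) {xs = divisors n₁} d∈
      ... | d∈divs , divides e refl = subst (_∈ map (p *_) (divisors n₀)) (*-comm p e)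
        (∈-map⁺ (p *_) (∈-divisors⁺ (*-cancelˡ-∣ p
          (subst₂ _∣_ (*-comm e p) n₁≡pn₀ (∈-divisors⁻ d∈divs)))))
      from : ∀ {d} → d ∈ map (p *_) (divisors n₀) → d ∈ filter (p ∣?_) (divisors n₁)
      from d∈ with ∈-map⁻ (p *_) d∈
      ... | e , e∈ , refl = ∈-filter⁺ (p ∣?_)
        (∈-divisors⁺ (subst (p * e ∣_) (sym n₁≡pn₀) (*-monoʳ-∣ p (∈-divisors⁻ e∈)))) (m∣m*n e)

    p∤-part : filter (∁? (p ∣?_)) (divisors n₁) ↭ divisors m
    p∤-part = ∈-≐⇒↭ (Unique.filter⁺ (∁? (p ∣?_)) (divisors-unique n₁)) (divisors-unique m) to from
      where
      to : ∀ {d} → d ∈ filter (∁? (p ∣?_)) (divisors n₁) → d ∈ divisors m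
      to d∈ with ∈-filter⁻ (∁? (p ∣?_)) {xs = divisors n₁} d∈
      ... | d∈divs , p∤d =
        ∈-divisors⁺ (coprime-divisor (coprime-^ (prime∤⇒coprime pr p∤d) (suc a)) (∈-divisors⁻ d∈divs))
      from : ∀ {d} → d ∈ divisors m → d ∈ filter (∁? (p ∣?_)) (divisors n₁)
      from d∈ = ∈-filter⁺ (∁? (p ∣?_)) (∈-divisors⁺ (∣n⇒∣m*n (p ^ suc a) (∈-divisors⁻ d∈)))
                  (λ p∣d → p∤m (∣-trans p∣d (∈-divisors⁻ d∈)))

prime-power-part : 2 ≤ p → ∀ n .{{_ : NonZero n}} → ∃[ a ] ∃[ m ] n ≡ p ^ a * m × ¬ p ∣ m
prime-power-part {p} 2≤p n = <-rec P step n (≢-nonZero⁻¹ n)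
  where
  P : ℕ → Set
  P n = n ≢ 0 → ∃[ a ] ∃[ m ] n ≡ p ^ a * m × ¬ p ∣ m
  step : ∀ n → (∀ {m} → m < n → P m) → P n
  step n rec n≢0 with p ∣? n
  ... | no p∤n = 0 , n , sym (*-identityˡ n) , p∤n
  ... | yes (divides zero n≡0) = contradiction n≡0 n≢0
  ... | yes (divides q@(suc _) refl) with rec (subst (_< q * p) (*-identityʳ q) (*-monoʳ-< q 2≤p)) (λ ())
  ...   | a , m , q≡ , p∤m = suc a , m ,
          trans (*-comm q p) (trans (cong (p *_) q≡) (sym (*-assoc p (p ^ a) m))) , p∤m

∃-prime-divisor : ∀ n .{{_ : NonZero n}} → n ≢ 1 → ∃[ p ] Prime p × p ∣ n
∃-prime-divisor n n≢1 with factorise n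
... | record { factors = [] ; isFactorisation = n≡1 } = contradiction n≡1 n≢1
... | record { factors = p ∷ ps ; isFactorisation = n≡ ; factorsPrime = pr All.∷ _ } =
  p , pr , subst (p ∣_) (sym n≡) (m∣m*n (product ps))

∣i∣≡1⇒i≡±1 : ∀ i → ∣ i ∣ ≡ 1 → i ≡ 1ℤ ⊎ i ≡ -1ℤ
∣i∣≡1⇒i≡±1 (+ 1)         refl = inj₁ refl
∣i∣≡1⇒i≡±1 (ℤ.-[1+ 0 ])  refl = inj₂ refl

∣i∣≡1⇒i*i≡1 : ∀ i → ∣ i ∣ ≡ 1 → i ℤ.* i ≡ 1ℤ
∣i∣≡1⇒i*i≡1 i ∣i∣≡1 with ∣i∣≡1⇒i≡±1 i ∣i∣≡1
... | inj₁ refl = refl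
... | inj₂ refl = refl

-- For the term of unknown sign in the recursion over prime powers, which is bounded by its worst
-- case.
∣i∣≡1⇒-j≤i*j : ∀ i j → ∣ i ∣ ≡ 1 → 0ℤ ℤ.≤ j → ℤ.- j ℤ.≤ i ℤ.* j
∣i∣≡1⇒-j≤i*j i j ∣i∣≡1 0≤j with ∣i∣≡1⇒i≡±1 i ∣i∣≡1
... | inj₁ refl = ℤ.≤-trans (ℤ.neg-mono-≤ 0≤j) (ℤ.≤-trans 0≤j (ℤ.≤-reflexive (sym (ℤ.*-identityˡ j))))
... | inj₂ refl = ℤ.≤-reflexive (sym (ℤ.-1*i≡-i j))

-- A product of naturals equal to 1 has both factors 1. This hands the hypothesis on `n` in the
-- induction down to its prime `p` and its cofactor `m`.
multiplicative-∣ : ∀ f → Multiplicative f → d ∣ n → ∣ f n ∣ ≡ 1 → ∣ f d ∣ ≡ 1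
multiplicative-∣ {d} f f-* (divides q refl) ∣fn∣≡1 =
  m*n≡1⇒n≡1 ∣ f q ∣ _ (trans (sym (trans (cong ∣_∣ (f-* q d)) (ℤ.abs-* (f q) (f d)))) ∣fn∣≡1)

twist : (ℕ → ℤ) → ℕ → ℕ → ℤ
twist f m d = f d ℤ.* (+ d) ℤ.^ m

interchange : ∀ a b c d → (a ℤ.* b) ℤ.* (c ℤ.* d) ≡ (a ℤ.* c) ℤ.* (b ℤ.* d)
interchange = ℤ.solve-∀

^-distribʳ-* : ∀ i j k → (i ℤ.* j) ℤ.^ k ≡ i ℤ.^ k ℤ.* j ℤ.^ k
^-distribʳ-* i j zero    = refl
^-distribʳ-* i j (suc k) = trans (cong (i ℤ.* j ℤ.*_) (^-distribʳ-* i j k))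
  (interchange i j (i ℤ.^ k) (j ℤ.^ k))

twist-* : ∀ f → Multiplicative f → ∀ m → Multiplicative (twist f m)
twist-* f f-* m a b = trans
  (cong₂ ℤ._*_ (f-* a b) (trans (cong (ℤ._^ m) (ℤ.pos-* a b)) (^-distribʳ-* (+ a) (+ b) m)))
  (interchange (f a) (f b) ((+ a) ℤ.^ m) ((+ b) ℤ.^ m))

pos-^ : ∀ a k → (+ a) ℤ.^ k ≡ + (a ^ k)
pos-^ a zero    = refl
pos-^ a (suc k) = trans (cong (+ a ℤ.*_) (pos-^ a k)) (sym (ℤ.pos-* a (a ^ k)))

module _ (f : ℕ → ℤ) (f-* : Multiplicative f) (k : ℕ) where
  private
    G = divisorSum (twist f (suc k))

  -- For W a = f(pᵃm) G(pᵃm) the recursion for G reads W (a+1) = p^{k+1} W a ± W 0,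
  -- so W (a+1) ≥ 2 W a − W 0.
  prime-power-bound : Prime p → ∀ a m .{{_ : NonZero m}} → ¬ p ∣ m → ∣ f p ∣ ≡ 1 → ∣ f m ∣ ≡ 1 →
    0ℤ <ℤ f m ℤ.* G m → f m ℤ.* G m ℤ.≤ f (p ^ a * m) ℤ.* G (p ^ a * m)
  prime-power-bound {p} pr zero m p∤m _ _ _ =
    ℤ.≤-reflexive (cong (λ n → f n ℤ.* G n) (sym (*-identityˡ m)))
  prime-power-bound {p} pr (suc a) m p∤m fp fm W₀>0 = begin
    W₀ ≡⟨ arith₁ W₀ ⟩
    + 2 ℤ.* W₀ ℤ.+ ℤ.- W₀
      -- In this estimate positivity of `W` alone would not absorb `u ℤ.* W₀`. The induction
      -- therefore carries W₀ ≤ W, which also makes `W` nonnegative for replacing 2 by `Q`.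
      ≤⟨ ℤ.+-mono-≤ (ℤ.*-monoˡ-≤-nonNeg (+ 2) ih) (∣i∣≡1⇒-j≤i*j u W₀ ∣u∣≡1 (ℤ.<⇒≤ W₀>0)) ⟩
    + 2 ℤ.* W ℤ.+ u ℤ.* W₀
      ≤⟨ ℤ.+-monoˡ-≤ (u ℤ.* W₀)
           (ℤ.*-monoʳ-≤-nonNeg W {{ℤ.nonNegative (ℤ.≤-trans (ℤ.<⇒≤ W₀>0) ih)}} 2≤Q) ⟩
    Q ℤ.* W ℤ.+ u ℤ.* W₀
      -- A factor f(p)² = 1 is inserted: one `f p` turns `f n₀` into `f n₁`, the other turns `Q`
      -- into the value of the twist at `p`.
      ≡⟨ cong (ℤ._+ u ℤ.* W₀) (trans (sym (ℤ.*-identityˡ (Q ℤ.* W)))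
           (cong (ℤ._* (Q ℤ.* W)) (sym (∣i∣≡1⇒i*i≡1 (f p) fp)))) ⟩
    f p ℤ.* f p ℤ.* (Q ℤ.* W) ℤ.+ u ℤ.* W₀
      ≡⟨ arith₂ (f p) Q (f n₀) (G n₀) u (f m) (G m) ⟩
    f p ℤ.* f n₀ ℤ.* (f p ℤ.* Q ℤ.* G n₀) ℤ.+ u ℤ.* f m ℤ.* G m
      ≡⟨ cong₂ (λ x y → x ℤ.* (f p ℤ.* Q ℤ.* G n₀) ℤ.+ y ℤ.* G m)
           (trans (sym (f-* p n₀)) (cong f (sym (*-assoc p (p ^ a) m)))) (sym (f-* (p ^ suc a) m)) ⟩
    f n₁ ℤ.* (f p ℤ.* Q ℤ.* G n₀) ℤ.+ f n₁ ℤ.* G m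
      ≡⟨ ℤ.*-distribˡ-+ (f n₁) _ _ ⟨
    f n₁ ℤ.* (f p ℤ.* Q ℤ.* G n₀ ℤ.+ G m)
      ≡⟨ cong (f n₁ ℤ.*_) (divisorSum-prime-power (twist-* f f-* (suc k)) pr a m p∤m) ⟨
    f n₁ ℤ.* G n₁ ∎
    where
    open ℤ.≤-Reasoning
    n₀  = p ^ a * m
    n₁ = p ^ suc a * m
    W₀ = f m ℤ.* G m
    W  = f n₀ ℤ.* G n₀
    Q  = (+ p) ℤ.^ suc k
    u  = f (p ^ suc a)
    ih : W₀ ℤ.≤ W
    ih = prime-power-bound pr a m p∤m fp fm W₀>0
    ∣f[p^_]∣≡1 : ∀ b → ∣ f (p ^ suc b) ∣ ≡ 1
    ∣f[p^ zero  ]∣≡1 = trans (cong (∣_∣ ∘ f) (*-identityʳ p)) fp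
    ∣f[p^ suc b ]∣≡1 = trans (cong ∣_∣ (f-* p (p ^ suc b)))
      (trans (ℤ.abs-* (f p) _) (cong₂ _*_ fp ∣f[p^ b ]∣≡1))
    ∣u∣≡1 : ∣ u ∣ ≡ 1
    ∣u∣≡1 = ∣f[p^ a ]∣≡1
    2≤Q : + 2 ℤ.≤ Q
    2≤Q = subst (+ 2 ℤ.≤_) (sym (pos-^ p (suc k)))
      (ℤ.+≤+ (≤-trans (nonTrivial⇒n>1 p {{prime⇒nonTrivial pr}})
        (m≤m*n p (p ^ k) {{m^n≢0 p k {{prime⇒nonZero pr}}}})))
    arith₁ : ∀ w → w ≡ + 2 ℤ.* w ℤ.+ ℤ.- w
    arith₁ = ℤ.solve-∀
    arith₂ : ∀ x q y z u v w → x ℤ.* x ℤ.* (q ℤ.* (y ℤ.* z)) ℤ.+ u ℤ.* (v ℤ.* w)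
           ≡ x ℤ.* y ℤ.* (x ℤ.* q ℤ.* z) ℤ.+ u ℤ.* v ℤ.* w
    arith₂ = ℤ.solve-∀

  -- At 1 the product is f(1)² = 1, and `prime-power-bound` carries positivity from `m` to p^a m
  -- when `p` does not divide `m`. Strong induction thus removes the full power of one prime at a
  -- time.
  divisorSum-sign : ∀ n → n ≢ 0 → ∣ f n ∣ ≡ 1 → 0ℤ <ℤ f n ℤ.* G n
  divisorSum-sign = <-rec P step
    where
    P : ℕ → Set
    P n = n ≢ 0 → ∣ f n ∣ ≡ 1 → 0ℤ <ℤ f n ℤ.* G n

    G1≡f1 : G 1 ≡ f 1
    G1≡f1 = trans (ℤ.+-identityʳ _) (trans (cong (f 1 ℤ.*_) (ℤ.^-zeroˡ (suc k))) (ℤ.*-identityʳ (f 1)))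

    step : ∀ n → (∀ {m} → m < n → P m) → P n
    step n rec n≢0 fn with n ≟ 1
    ... | yes refl = subst (0ℤ <ℤ_)
      (sym (trans (cong (f 1 ℤ.*_) G1≡f1) (∣i∣≡1⇒i*i≡1 (f 1) fn))) (ℤ.+<+ z<s)
    ... | no  n≢1
      with ∃-prime-divisor n {{≢-nonZero n≢0}} n≢1
    ...   | p , pr , p∣n
        with prime-power-part (nonTrivial⇒n>1 p {{prime⇒nonTrivial pr}}) n {{≢-nonZero n≢0}}
    ...     | a , m , refl , p∤m =
      ℤ.<-≤-trans W₀>0 (prime-power-bound pr a m {{m≢0}} p∤m fp fm W₀>0)
      where
      m≢0 : NonZero m
      m≢0 = ≢-nonZero (λ { refl → p∤m (p ∣0) })
      fp : ∣ f p ∣ ≡ 1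
      fp = multiplicative-∣ f f-* p∣n fn
      fm : ∣ f m ∣ ≡ 1
      fm = multiplicative-∣ f f-* (n∣m*n (p ^ a)) fn
      m<n : m < p ^ a * m
      m<n = ≤∧≢⇒< (∣⇒≤ {{≢-nonZero n≢0}} (n∣m*n (p ^ a))) (λ m≡n → p∤m (subst (p ∣_) (sym m≡n) p∣n))
      W₀>0 = rec m<n (≢-nonZero⁻¹ m {{m≢0}}) fm

-- Periodic functions and their partial sums

coprime-inverse : .{{_ : NonZero N}} → Coprime a N → ∃[ b ] (a * b) % N ≡ 1 % N
coprime-inverse {N@(suc N-1)} {a} c with Coprimality.coprime-Bézout c
... | Bézout.+- x y eq = x , (begin
  (a * x) % N     ≡⟨ cong (_% N) (*-comm a x) ⟩
  (x * a) % N     ≡⟨ cong (_% N) eq ⟨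
  (1 + y * N) % N ≡⟨ [m+kn]%n≡m%n 1 y N ⟩
  1 % N           ∎)
  where open ≡-Reasoning
-- Here x a ≡ −1 mod N, so −x, represented by x (N − 1), is the inverse.
... | Bézout.-+ x y eq = x * N-1 , (begin
  (a * (x * N-1)) % N                ≡⟨ [m+n]%n≡m%n (a * (x * N-1)) N ⟨
  (a * (x * N-1) + N) % N            ≡⟨ cong (_% N) (arith₁ a x N-1) ⟩
  (1 + (N-1 * (1 + x * a))) % N      ≡⟨ cong (λ z → (1 + N-1 * z) % N) eq ⟩
  (1 + (N-1 * (y * N))) % N          ≡⟨ cong (λ z → (1 + z) % N) (sym (*-assoc N-1 y N)) ⟩
  (1 + N-1 * y * N) % N              ≡⟨ [m+kn]%n≡m%n 1 (N-1 * y) N ⟩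
  1 % N                              ∎)
  where
  open ≡-Reasoning
  arith₁ : ∀ a x m → a * (x * m) + suc m ≡ 1 + m * (1 + x * a)
  arith₁ = ℕ.solve-∀

%-cong-* : ∀ a b {c d} m .{{_ : NonZero m}} →
           a % m ≡ c % m → b % m ≡ d % m → (a * b) % m ≡ (c * d) % m
%-cong-* a b {c} {d} m a≡c b≡d = trans (%-distribˡ-* a b m)
  (trans (cong₂ (λ x y → (x * y) % m) a≡c b≡d) (sym (%-distribˡ-* c d m)))

*-%-cancel : .{{_ : NonZero N}} → ∀ a b → (a * b) % N ≡ 1 % N →
             ∀ x → (b * ((a * x) % N)) % N ≡ x % N
*-%-cancel {N} a b ab≡1 x = begin
  (b * ((a * x) % N)) % N ≡⟨ %-cong-* b ((a * x) % N) {b} {a * x} N refl (m%n%n≡m%n (a * x) N) ⟩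
  (b * (a * x)) % N       ≡⟨ cong (_% N) (arith b a x) ⟩
  (a * b * x) % N         ≡⟨ %-cong-* (a * b) x {1} {x} N ab≡1 refl ⟩
  (1 * x) % N             ≡⟨ cong (_% N) (*-identityˡ x) ⟩
  x % N                   ∎
  where
  open ≡-Reasoning
  arith : ∀ b a x → b * (a * x) ≡ a * b * x
  arith = ℕ.solve-∀

-- Multiplication by `b` undoes multiplication by `a`, which gives injectivity; with the roles
-- exchanged it gives surjectivity. Writing `1 % N` instead of 1 covers the modulus 1.
residues-↭ : .{{_ : NonZero N}} → ∀ a b → (a * b) % N ≡ 1 % N →
             applyUpTo (λ i → (a * i) % N) N ↭ upTo N
residues-↭ {N} a b ab≡1 = ∈-≐⇒↭ (Unique.applyUpTo⁺₁ _ N injective) (Unique.upTo⁺ N) to from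
  where
  injective : ∀ {i j} → i < j → j < N → (a * i) % N ≢ (a * j) % N
  injective {i} {j} i<j j<N eq = <⇒≢ i<j (begin
    i                        ≡⟨ m<n⇒m%n≡m (<-trans i<j j<N) ⟨
    i % N                    ≡⟨ *-%-cancel a b ab≡1 i ⟨
    (b * ((a * i) % N)) % N  ≡⟨ cong (λ z → (b * z) % N) eq ⟩
    (b * ((a * j) % N)) % N  ≡⟨ *-%-cancel a b ab≡1 j ⟩
    j % N                    ≡⟨ m<n⇒m%n≡m j<N ⟩
    j                        ∎)
    where open ≡-Reasoning
  to : ∀ {x} → x ∈ applyUpTo (λ i → (a * i) % N) N → x ∈ upTo N
  to x∈ with ∈-applyUpTo⁻ _ x∈
  ... | i , _ , refl = ∈-upTo⁺ (m%n<n (a * i) N)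
  from : ∀ {x} → x ∈ upTo N → x ∈ applyUpTo (λ i → (a * i) % N) N
  from {x} x∈ = subst (_∈ applyUpTo (λ i → (a * i) % N) N)
    (trans (*-%-cancel b a (trans (cong (_% N) (*-comm b a)) ab≡1) x) (m<n⇒m%n≡m (∈-upTo⁻ x∈)))
    (∈-applyUpTo⁺ (λ i → (a * i) % N) (m%n<n (b * x) N))

Periodic : ℕ → (ℕ → ℤ) → Set
Periodic N t = ∀ n → t (n + N) ≡ t n

partialSum : (ℕ → ℤ) → ℕ → ℤ
partialSum t n = sumℤ (map t (upTo n))

sumℤ-∷ʳ : ∀ xs x → sumℤ (xs ∷ʳ x) ≡ sumℤ xs ℤ.+ x
sumℤ-∷ʳ []       x = ℤ.+-comm x 0ℤ
sumℤ-∷ʳ (y ∷ xs) x = trans (cong (ℤ._+_ y) (sumℤ-∷ʳ xs x)) (sym (ℤ.+-assoc y (sumℤ xs) x))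

partialSum-suc : ∀ t n → partialSum t (suc n) ≡ partialSum t n ℤ.+ t n
partialSum-suc t n = begin
  sumℤ (map t (upTo (suc n)))        ≡⟨ cong (sumℤ ∘ map t) (upTo-∷ʳ n) ⟨
  sumℤ (map t (upTo n ∷ʳ n))    ≡⟨ cong sumℤ (map-++ t (upTo n) (n ∷ [])) ⟩
  sumℤ (map t (upTo n) ∷ʳ t n)  ≡⟨ sumℤ-∷ʳ (map t (upTo n)) (t n) ⟩
  partialSum t n ℤ.+ t n             ∎
  where open ≡-Reasoning

module _ {t : ℕ → ℤ} (periodic : Periodic N t) where

  periodic-* : ∀ n k → t (n + k * N) ≡ t n
  periodic-* n zero    = cong t (+-identityʳ n)
  periodic-* n (suc k) = begin
    t (n + (N + k * N)) ≡⟨ cong t (trans (cong (_+_ n) (+-comm N (k * N)))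
                                 (sym (+-assoc n (k * N) N))) ⟩
    t (n + k * N + N)   ≡⟨ periodic (n + k * N) ⟩
    t (n + k * N)       ≡⟨ periodic-* n k ⟩
    t n                 ∎
    where open ≡-Reasoning

  periodic-% : .{{_ : NonZero N}} → ∀ n → t (n % N) ≡ t n
  periodic-% n = trans (sym (periodic-* (n % N) (n / N))) (cong t (sym (m≡m%n+[m/n]*n n N)))

  -- Multiplication by `a` permutes the residues, so the sum S over a period satisfies S = t(a) S =
  -- -S.
  orthogonality : .{{_ : NonZero N}} → Multiplicative t → Coprime a N → t a ≡ -1ℤ →
                  partialSum t N ≡ 0ℤ
  orthogonality {a = a} t-* c ta≡-1 with coprime-inverse c
  ... | b , ab≡1 = self-neg (begin
    partialSum t N
      ≡⟨ sumℤ-↭ (map⁺ t (residues-↭ a b ab≡1)) ⟨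
    sumℤ (map t (applyUpTo (λ i → (a * i) % N) N))
      ≡⟨ cong (sumℤ ∘ map t) (map-upTo _ N) ⟨
    sumℤ (map t (map (λ i → (a * i) % N) (upTo N)))
      ≡⟨ cong sumℤ (map-∘ (upTo N)) ⟨
    sumℤ (map (λ i → t ((a * i) % N)) (upTo N))
      ≡⟨ cong sumℤ (map-cong (λ i → trans (periodic-% (a * i)) (t-* a i)) (upTo N)) ⟩
    sumℤ (map (λ i → t a ℤ.* t i) (upTo N))
      ≡⟨ sumℤ-map-*ˡ (t a) t (upTo N) ⟩
    t a ℤ.* partialSum t N
      ≡⟨ cong (ℤ._* partialSum t N) ta≡-1 ⟩
    -1ℤ ℤ.* partialSum t N
      ≡⟨ ℤ.-1*i≡-i _ ⟩
    ℤ.- partialSum t N ∎)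
    where
    open ≡-Reasoning
    self-neg : ∀ {i} → i ≡ ℤ.- i → i ≡ 0ℤ
    -- A nonzero integer and its negative have different constructors, so coverage leaves only zero.
    self-neg {+ zero}     _ = refl

  partialSum-+ : partialSum t N ≡ 0ℤ → ∀ n → partialSum t (n + N) ≡ partialSum t n
  partialSum-+ S≡0 zero    = S≡0
  partialSum-+ S≡0 (suc n) = trans (partialSum-suc t (n + N))
    (trans (cong₂ ℤ._+_ (partialSum-+ S≡0 n) (periodic n)) (sym (partialSum-suc t n)))

partialSum-≤ : ∀ {t} → (∀ n → ∣ t n ∣ ≤ 1) → ∀ n → ∣ partialSum t n ∣ ≤ n
partialSum-≤ {t} t≤1 zero    = z≤n
partialSum-≤ {t} t≤1 (suc n) = begin
  ∣ partialSum t (suc n) ∣        ≡⟨ cong ∣_∣ (partialSum-suc t n) ⟩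
  ∣ partialSum t n ℤ.+ t n ∣      ≤⟨ ℤ.∣i+j∣≤∣i∣+∣j∣ (partialSum t n) (t n) ⟩
  ∣ partialSum t n ∣ + ∣ t n ∣    ≤⟨ +-mono-≤ (partialSum-≤ t≤1 n) (t≤1 n) ⟩
  n + 1                           ≡⟨ +-comm n 1 ⟩
  suc n                           ∎
  where open ≤-Reasoning

-- Since the sum over a period vanishes, the partial sums are themselves periodic. Only `n % N`
-- terms remain, each at most 1 in absolute value.
partialSum-bounded : .{{_ : NonZero N}} → ∀ {t} → Periodic N t → partialSum t N ≡ 0ℤ →
                     (∀ n → ∣ t n ∣ ≤ 1) → ∀ n → ∣ partialSum t n ∣ ≤ N
partialSum-bounded {N} {t} periodic S≡0 t≤1 n = begin
  ∣ partialSum t n ∣         ≡⟨ cong ∣_∣ (periodic-% (partialSum-+ periodic S≡0) n) ⟨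
  ∣ partialSum t (n % N) ∣   ≤⟨ partialSum-≤ t≤1 (n % N) ⟩
  n % N                      ≤⟨ m%n≤n n N ⟩
  N                          ∎
  where open ≤-Reasoning

-- Quadratic characters

-- One prime is treated at a time: if `p` divides a + s b, then `s` is moved by the product of the
-- primes treated before, which keeps the value prime to that product.
coprime-shift-product : Coprime a b → ∀ {ps} → All Prime ps →
                        ∃[ s ] Coprime (a + s * b) (product ps)
coprime-shift-product {a} {b} a⊥b [] = 0 , Coprimality.sym (Coprimality.1-coprimeTo _)
coprime-shift-product {a} {b} a⊥b {p ∷ ps} (pr ∷ prs)
  with s , c ← coprime-shift-product a⊥b prs
  with p ∣? a + s * b
... | no  p∤ = s , coprime-* (prime∤⇒coprime pr p∤) c
... | yes p∣ = s + M ,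
  subst (λ z → Coprime z (p * M)) (sym regroup) (coprime-* (prime∤⇒coprime pr p∤) c′)
  where
  M = product ps
  regroup : a + (s + M) * b ≡ (a + s * b) + M * b
  regroup = trans (cong (_+_ a) (*-distribʳ-+ b s M)) (sym (+-assoc a (s * b) (M * b)))
  c′ : Coprime (a + s * b + M * b) M
  c′ {d} (d∣ , d∣M) =
    c (∣m+n∣m⇒∣n (subst (d ∣_) (+-comm (a + s * b) (M * b)) d∣) (∣m⇒∣m*n b d∣M) , d∣M)
  p∤ : ¬ p ∣ a + s * b + M * b
  -- By subtraction `p` would divide M b. It cannot divide `M`, to which a + s b is prime, nor `b`,
  -- since it would then divide `a` as well.
  p∤ p∣′ with euclidsLemma M b pr (∣m+n∣m⇒∣n p∣′ p∣)
  ... | inj₁ p∣M = ¬prime[1] (subst Prime (c (p∣ , p∣M)) pr)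
  ... | inj₂ p∣b = ¬prime[1] (subst Prime (a⊥b (p∣a , p∣b)) pr)
    where p∣a = ∣m+n∣m⇒∣n (subst (p ∣_) (+-comm a (s * b)) p∣) (∣n⇒∣m*n s p∣b)

-- Used to move an argument with character value -1 within its residue class until it is also prime
-- to the other modulus.
coprime-shift : Coprime a b → ∀ M .{{_ : NonZero M}} → ∃[ s ] Coprime (a + s * b) M
coprime-shift {a} {b} a⊥b M with factorise M
... | record { factors = ps ; isFactorisation = M≡ ; factorsPrime = prs } with coprime-shift-product a⊥b prs
...   | s , c = s , subst (Coprime (a + s * b)) (sym M≡) c

module _ (ψ : DirichletCharacter N) where
  open DirichletCharacter ψ using (periodic; multiplicative; support)

  χℕ : ℕ → ℤ
  χℕ n = χ ψ (+ n)

  χℕ-* : Multiplicative χℕ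
  χℕ-* a b = trans (cong (χ ψ) (ℤ.pos-* a b)) (multiplicative (+ a) (+ b))

  χℕ-periodic : Periodic N χℕ
  χℕ-periodic n = trans (cong (χ ψ) (ℤ.pos-+ n N)) (periodic (+ n))

  χℕ-1 : χℕ 1 ≡ 1ℤ
  χℕ-1 = ℤ.*-cancelˡ-≡ (χℕ 1) (χℕ 1) 1ℤ {{ℤ.≢-nonZero χ1≢0}}
           (trans (sym (χℕ-* 1 1)) (sym (ℤ.*-identityʳ (χℕ 1))))
    where
    χ1≢0 : χℕ 1 ≢ 0ℤ
    χ1≢0 = Equivalence.from (support 1ℤ) (Coprimality.1-coprimeTo N)

  χℕ-¬coprime : ¬ Coprime n N → χℕ n ≡ 0ℤ
  χℕ-¬coprime {n} ¬c with χℕ n ℤ.≟ 0ℤ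
  ... | yes χn≡0 = χn≡0
  ... | no  χn≢0 = ⊥-elim (¬c (Equivalence.to (support (+ n)) χn≢0))

  χ-periodic-*ℕ : ∀ a k → χ ψ (a ℤ.+ + k ℤ.* + N) ≡ χ ψ a
  χ-periodic-*ℕ a zero    = cong (χ ψ) (ℤ.+-identityʳ a)
  χ-periodic-*ℕ a (suc k) = begin
    χ ψ (a ℤ.+ + suc k ℤ.* + N)         ≡⟨ cong (χ ψ) (arith a (+ k) (+ N)) ⟩
    χ ψ (a ℤ.+ + k ℤ.* + N ℤ.+ + N)     ≡⟨ periodic _ ⟩
    χ ψ (a ℤ.+ + k ℤ.* + N)             ≡⟨ χ-periodic-*ℕ a k ⟩
    χ ψ a                               ∎
    where
    open ≡-Reasoning
    arith : ∀ a k n → a ℤ.+ (1ℤ ℤ.+ k) ℤ.* n ≡ a ℤ.+ k ℤ.* n ℤ.+ n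
    arith = ℤ.solve-∀

  χ-periodic-* : ∀ a k → χ ψ (a ℤ.+ k ℤ.* + N) ≡ χ ψ a
  χ-periodic-* a (+ k)        = χ-periodic-*ℕ a k
  -- For a negative multiple, adding the same multiple back reduces to the natural case.
  χ-periodic-* a k@(ℤ.-[1+ j ]) = trans (sym (χ-periodic-*ℕ (a ℤ.+ k ℤ.* + N) (suc j)))
    (cong (χ ψ) (arith a (+ suc j) (+ N)))
    where
    arith : ∀ a k n → a ℤ.+ ℤ.- k ℤ.* n ℤ.+ k ℤ.* n ≡ a
    arith = ℤ.solve-∀

  -- `IsPrincipal` ranges over all integers, negative ones included; this reduces it to finitely
  -- many natural residues.
  χ-%ℕ : .{{_ : NonZero N}} → ∀ a → χℕ (a ℤ.%ℕ N) ≡ χ ψ a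
  χ-%ℕ a = trans (sym (χ-periodic-* (+ (a ℤ.%ℕ N)) (a ℤ./ℕ N)))
    (cong (χ ψ) (sym (ℤ.a≡a%ℕn+[a/ℕn]*n a N)))

  module _ (q : Quadratic ψ) where

    χℕ-coprime : Coprime n N → ∣ χℕ n ∣ ≡ 1
    χℕ-coprime {n} c = m*n≡1⇒n≡1 ∣ χℕ n ∣ _
      (trans (sym (ℤ.abs-* (χℕ n) (χℕ n))) (cong ∣_∣ (proj₂ q (+ n) c)))

    ∣χℕ∣≤1 : ∀ n → ∣ χℕ n ∣ ≤ 1
    ∣χℕ∣≤1 n with coprime? n N
    ... | yes c = ≤-reflexive (χℕ-coprime c)
    ... | no ¬c = subst (λ z → ∣ z ∣ ≤ 1) (sym (χℕ-¬coprime ¬c)) z≤n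

    -- On residues prime to `N` the values are 1 and -1. If a search through one period finds no -1,
    -- the character is principal, against `Quadratic`.
    ∃-χℕ≡-1 : .{{_ : NonZero N}} → ∃[ a ] Coprime a N × χℕ a ≡ -1ℤ
    ∃-χℕ≡-1 with anyUpTo? (λ a → coprime? a N ×-dec χℕ a ℤ.≟ -1ℤ) N
    ... | yes (a , _ , c , χa≡-1) = a , c , χa≡-1
    ... | no ∄a = contradiction principal (proj₁ q)
      where
      principal : IsPrincipal N (χ ψ)
      principal a c = subst (_≡ 1ℤ) (χ-%ℕ a) χr≡1
        where
        r = a ℤ.%ℕ N
        r⊥N : Coprime r N
        r⊥N = Equivalence.to (support (+ r))
          (subst (_≢ 0ℤ) (sym (χ-%ℕ a)) (Equivalence.from (support a) c))
        χr≡1 : χℕ r ≡ 1ℤ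
        χr≡1 with ∣i∣≡1⇒i≡±1 (χℕ r) (χℕ-coprime r⊥N)
        ... | inj₁ χr≡1  = χr≡1
        ... | inj₂ χr≡-1 = ⊥-elim (∄a (r , ℤ.n%ℕd<d a N , r⊥N , χr≡-1))

    ∃-coprime-χℕ≡-1 : .{{_ : NonZero N}} → ∀ M .{{_ : NonZero M}} →
                      ∃[ a ] Coprime a M × Coprime a N × χℕ a ≡ -1ℤ
    ∃-coprime-χℕ≡-1 M with a , a⊥N , χa≡-1 ← ∃-χℕ≡-1
      with s , c ← coprime-shift a⊥N M =
      a + s * N , c ,
      Equivalence.to (support (+ (a + s * N))) (subst (_≢ 0ℤ) (sym χa′≡-1) (λ ())) , χa′≡-1
      where
      χa′≡-1 = trans (periodic-* χℕ-periodic a s) χa≡-1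

-- Twisted divisor sums

module _ {N₁ N₂} (ψ₁ : DirichletCharacter N₁) (ψ₂ : DirichletCharacter N₂)
         (q₁ : Quadratic ψ₁) (q₂ : Quadratic ψ₂) where

  χχ : ℕ → ℤ
  χχ n = χℕ ψ₁ n ℤ.* χℕ ψ₂ n

  χχ-* : Multiplicative χχ
  χχ-* a b = trans (cong₂ ℤ._*_ (χℕ-* ψ₁ a b) (χℕ-* ψ₂ a b))
    (interchange (χℕ ψ₁ a) (χℕ ψ₁ b) (χℕ ψ₂ a) (χℕ ψ₂ b))

  -- A divisor of `n` is prime to `N₁` as well, so χ₁(d)² = 1 and dividing by χ₁(d) is multiplying
  -- by it.
  χℕ-quotient : Coprime n N₁ → ∀ d .{{_ : NonZero d}} → d ∣ n → χℕ ψ₁ (n / d) ≡ χℕ ψ₁ n ℤ.* χℕ ψ₁ d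
  χℕ-quotient {n} n⊥N₁ d d∣n = begin
    χℕ ψ₁ e                             ≡⟨ ℤ.*-identityʳ (χℕ ψ₁ e) ⟨
    χℕ ψ₁ e ℤ.* 1ℤ                      ≡⟨ cong (χℕ ψ₁ e ℤ.*_) (∣i∣≡1⇒i*i≡1 (χℕ ψ₁ d) ∣χd∣≡1) ⟨
    χℕ ψ₁ e ℤ.* (χℕ ψ₁ d ℤ.* χℕ ψ₁ d)   ≡⟨ ℤ.*-assoc (χℕ ψ₁ e) _ _ ⟨
    χℕ ψ₁ e ℤ.* χℕ ψ₁ d ℤ.* χℕ ψ₁ d     ≡⟨ cong (ℤ._* χℕ ψ₁ d) (χℕ-* ψ₁ e d) ⟨
    χℕ ψ₁ (e * d) ℤ.* χℕ ψ₁ d           ≡⟨ cong (λ m → χℕ ψ₁ m ℤ.* χℕ ψ₁ d) (m/n*n≡m d∣n) ⟩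
    χℕ ψ₁ n ℤ.* χℕ ψ₁ d                 ∎
    where
    open ≡-Reasoning
    e = n / d
    ∣χd∣≡1 = χℕ-coprime ψ₁ q₁ (coprime-∣ˡ d∣n n⊥N₁)

  σ≡χ₁*divisorSum : ∀ m → Coprime n N₁ → σ ψ₁ ψ₂ m n ≡ χℕ ψ₁ n ℤ.* divisorSum (twist χχ m) n
  σ≡χ₁*divisorSum {n} m n⊥N₁ = begin
    σ ψ₁ ψ₂ m n
      -- The terms are compared only at divisors of `n`; the filter supplies the divisibility.
      ≡⟨ cong sumℤ (map-cong-local
           (All.map (λ {i} → term≡ i) (all-filter (λ i → suc i ∣? n) (upTo n)))) ⟩
    sumℤ (map (λ i → χℕ ψ₁ n ℤ.* twist χχ m (suc i)) L)
      ≡⟨ sumℤ-map-*ˡ (χℕ ψ₁ n) (twist χχ m ∘ suc) L ⟩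
    χℕ ψ₁ n ℤ.* sumℤ (map (twist χχ m ∘ suc) L)
      ≡⟨ cong (λ xs → χℕ ψ₁ n ℤ.* sumℤ xs) (map-∘ L) ⟩
    χℕ ψ₁ n ℤ.* divisorSum (twist χχ m) n ∎
    where
    open ≡-Reasoning
    L = filter (λ i → suc i ∣? n) (upTo n)
    arith : ∀ x y z w → x ℤ.* y ℤ.* z ℤ.* w ≡ x ℤ.* (y ℤ.* z ℤ.* w)
    arith = ℤ.solve-∀
    term≡ : ∀ i → suc i ∣ n → χ ψ₁ (+ (n / suc i)) ℤ.* χ ψ₂ (+ suc i) ℤ.* (+ suc i) ℤ.^ m
                              ≡ χℕ ψ₁ n ℤ.* twist χχ m (suc i)
    term≡ i d∣n = trans
      (cong (λ x → x ℤ.* χℕ ψ₂ (suc i) ℤ.* (+ suc i) ℤ.^ m) (χℕ-quotient n⊥N₁ (suc i) d∣n))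
      (arith (χℕ ψ₁ n) (χℕ ψ₁ (suc i)) (χℕ ψ₂ (suc i)) ((+ suc i) ℤ.^ m))

  -- Taking χ₁(n) out of `σ` turns the product into χ₁χ₂(n) times the divisor sum of the twist. The
  -- exponent is written `suc k` to be positive, whence p^(k+1) ≥ 2.
  σ-sign : ∀ k → n ≢ 0 → Coprime n N₁ → Coprime n N₂ → 0ℤ <ℤ χℕ ψ₂ n ℤ.* σ ψ₁ ψ₂ (suc k) n
  σ-sign {n} k n≢0 n⊥N₁ n⊥N₂ = subst (0ℤ <ℤ_)
    (trans (arith (χℕ ψ₁ n) (χℕ ψ₂ n) (divisorSum (twist χχ (suc k)) n))
      (cong (χℕ ψ₂ n ℤ.*_) (sym (σ≡χ₁*divisorSum (suc k) n⊥N₁))))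
    (divisorSum-sign χχ χχ-* k n n≢0
      (trans (ℤ.abs-* (χℕ ψ₁ n) (χℕ ψ₂ n))
        (cong₂ _*_ (χℕ-coprime ψ₁ q₁ n⊥N₁) (χℕ-coprime ψ₂ q₂ n⊥N₂))))
    where
    arith : ∀ x y z → x ℤ.* y ℤ.* z ≡ y ℤ.* (x ℤ.* z)
    arith = ℤ.solve-∀

-- Densities

module _ {P : Pred ℕ ℓ} (P? : Decidable P) where

  private
    count-suc : ∀ x → count P? (suc x) ≡ count P? x + length (filter P? (suc x ∷ []))
    count-suc x = begin
      length (filter P? (map suc (upTo (suc x))))
        ≡⟨ cong (length ∘ filter P? ∘ map suc) (upTo-∷ʳ x) ⟨
      length (filter P? (map suc (upTo x ∷ʳ x)))
        ≡⟨ cong (length ∘ filter P?) (map-++ suc (upTo x) (x ∷ [])) ⟩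
      length (filter P? (map suc (upTo x) ∷ʳ suc x))
        ≡⟨ cong length (filter-++ P? (map suc (upTo x)) _) ⟩
      length (filter P? (map suc (upTo x)) ++ filter P? (suc x ∷ []))
        ≡⟨ length-++ (filter P? (map suc (upTo x))) ⟩
      count P? x + length (filter P? (suc x ∷ [])) ∎
      where open ≡-Reasoning

  count-accept : ∀ {x} → P (suc x) → count P? (suc x) ≡ suc (count P? x)
  count-accept {x} px = trans (count-suc x)
    (trans (cong (λ xs → count P? x + length xs) (filter-accept P? px)) (+-comm (count P? x) 1))

  count-reject : ∀ {x} → ¬ P (suc x) → count P? (suc x) ≡ count P? x
  count-reject {x} ¬px = trans (count-suc x)
    (trans (cong (λ xs → count P? x + length xs) (filter-reject P? ¬px)) (+-identityʳ (count P? x)))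

  count-mono-≤ : ∀ {x y} → x ≤ y → count P? x ≤ count P? y
  count-mono-≤ {x} {y} x≤y with ≤⇒≤′ x≤y
  ... | ≤′-refl = ≤-refl
  ... | ≤′-step {y} x≤′y = ≤-trans (count-mono-≤ (≤′⇒≤ x≤′y))
    (subst (count P? y ≤_) (sym (count-suc y)) (m≤m+n (count P? y) _))

  -- The numbers 1 + iN with i < j are `j` hits not exceeding jN. This crude bound makes the
  -- denominators of the density tend to infinity.
  count-progression : .{{_ : NonZero N}} → (∀ j → P (suc (j * N))) → ∀ j → j ≤ count P? (j * N)
  count-progression hit zero = z≤n
  count-progression {N} hit (suc j) = begin
    suc j                    ≤⟨ s≤s (count-progression hit j) ⟩
    suc (count P? (j * N))   ≡⟨ count-accept (hit j) ⟨
    count P? (suc (j * N))   ≤⟨ count-mono-≤ (+-monoˡ-≤ (j * N) (>-nonZero⁻¹ N)) ⟩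
    count P? (N + j * N)     ∎
    where open ≤-Reasoning

-- With A hits among C candidates, `t` sums to A - (C - A) = 2A - C. `partialSum` starts at 0 and
-- stops before its bound, while `count` runs from 1 to `x`; hence `suc x` and the separate `t 0`.
count-bias : {Q : Pred ℕ ℓ} {P : Pred ℕ ℓ′} (Q? : Decidable Q) (P? : Decidable P) {t : ℕ → ℤ} →
  (∀ {n} → n ≢ 0 → Q n → P n → t n ≡ 1ℤ) →
  (∀ {n} → n ≢ 0 → Q n → ¬ P n → t n ≡ -1ℤ) →
  (∀ {n} → ¬ Q n → t n ≡ 0ℤ) →
  ∀ x → partialSum t (suc x) ≡ t 0 ℤ.+ (+ 2 ℤ.* + count (Q? ∩? P?) x ℤ.- + count Q? x)
count-bias Q? P? {t} t≡1 t≡-1 t≡0 zero = refl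
count-bias Q? P? {t} t≡1 t≡-1 t≡0 (suc x) = trans (partialSum-suc t (suc x))
  (trans (cong (ℤ._+ t (suc x)) (count-bias Q? P? t≡1 t≡-1 t≡0 x)) step)
  where
  A = count (Q? ∩? P?)
  C = count Q?
  arith₊ : ∀ t a c → t ℤ.+ (+ 2 ℤ.* a ℤ.- c) ℤ.+ 1ℤ ≡ t ℤ.+ (+ 2 ℤ.* (1ℤ ℤ.+ a) ℤ.- (1ℤ ℤ.+ c))
  arith₊ = ℤ.solve-∀
  arith₋ : ∀ t a c → t ℤ.+ (+ 2 ℤ.* a ℤ.- c) ℤ.+ -1ℤ ≡ t ℤ.+ (+ 2 ℤ.* a ℤ.- (1ℤ ℤ.+ c))
  arith₋ = ℤ.solve-∀
  step : t 0 ℤ.+ (+ 2 ℤ.* + A x ℤ.- + C x) ℤ.+ t (suc x)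
       ≡ t 0 ℤ.+ (+ 2 ℤ.* + A (suc x) ℤ.- + C (suc x))
  step with Q? (suc x)
  ... | no ¬q rewrite t≡0 ¬q | count-reject (Q? ∩? P?) {x} (¬q ∘ proj₁) | count-reject Q? {x} ¬q =
    ℤ.+-identityʳ _
  ... | yes q with P? (suc x)
  ...   | yes p rewrite t≡1 (λ ()) q p | count-accept (Q? ∩? P?) {x} (q , p) | count-accept Q? {x} q =
    arith₊ (t 0) (+ A x) (+ C x)
  ...   | no ¬p rewrite t≡-1 (λ ()) q ¬p | count-reject (Q? ∩? P?) {x} (¬p ∘ proj₂) | count-accept Q? {x} q =
    arith₋ (t 0) (+ A x) (+ C x)

-- The distance |p/q - 1/2| is |2p - q|/(2q), and |2p - q| (d+1) < q ≤ 2eq. In `ℚᵘ` the comparison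
-- with e/(d+1) is this cross-multiplication, free of reduction to lowest terms; q = c + 1 selects
-- the proper clause of `_÷_`.
÷-half-close : ∀ p q d e c .{{_ : NonZero e}} → ∣ + 2 ℤ.* + p ℤ.- + q ∣ * suc d < q →
               q ≡ suc c → toℚᵘ (ℚ.∣ p ÷ q ℚ.- ½ ∣) ℚᵘ.< mkℚᵘ (+ e) d
÷-half-close p q d e c bound refl = ℚᵘ.<-respˡ-≃ (ℚᵘ.≃-sym homo)
  (*<* (subst₂ _<ℤ_ (ℤ.pos-* ∣ + p ℤ.* + 2 ℤ.+ -1ℤ ℤ.* + q ∣ (suc d))
    (ℤ.pos-* e (q * 2)) (ℤ.+<+ nat)))
  where
  u : ℚᵘ
  u = ℚᵘ.∣ mkℚᵘ (+ p) c ℚᵘ.- mkℚᵘ 1ℤ 1 ∣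
  homo : toℚᵘ (ℚ.∣ p ÷ q ℚ.- ½ ∣) ℚᵘ.≃ u
  homo = ℚᵘ.≃-trans (ℚ.toℚᵘ-homo-∣-∣ (p ÷ q ℚ.- ½))
    (ℚᵘ.∣-∣-cong (ℚᵘ.≃-trans (ℚ.toℚᵘ-homo-+ (p ÷ q) (ℚ.- ½))
      (ℚᵘ.+-cong (ℚ.toℚᵘ-fromℚᵘ (mkℚᵘ (+ p) c)) (ℚᵘ.≃-refl {mkℚᵘ -1ℤ 1}))))
  nat : ∣ + p ℤ.* + 2 ℤ.+ -1ℤ ℤ.* + q ∣ * suc d < e * (q * 2)
  nat = begin-strict
    ∣ + p ℤ.* + 2 ℤ.+ -1ℤ ℤ.* + q ∣ * suc d ≡⟨ cong (λ z → ∣ z ∣ * suc d) (arith (+ p) (+ q)) ⟩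
    ∣ + 2 ℤ.* + p ℤ.- + q ∣ * suc d         <⟨ bound ⟩
    q                                       ≤⟨ m≤m*n q 2 ⟩
    q * 2                                   ≤⟨ m≤n*m (q * 2) e ⟩
    e * (q * 2)                             ∎
    where
    open ≤-Reasoning
    arith : ∀ p q → p ℤ.* + 2 ℤ.+ -1ℤ ℤ.* q ≡ + 2 ℤ.* p ℤ.- q
    arith = ℤ.solve-∀

-- The distance from 1/2 is |2A - C|/(2C), at most K/(2C), and C tends to infinity.
half-density : (A C : ℕ → ℕ) (K : ℕ) → (∀ x → ∣ + 2 ℤ.* + A x ℤ.- + C x ∣ ≤ K) →
               (∀ m → ∃[ X ] (∀ x → X ≤ x → m ≤ C x)) → (λ x → A x ÷ C x) TendsTo ½
half-density A C K bounded unbounded (mkℚ (+ 0)        d _) (ℚ.*<* (ℤ.+<+ ()))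
half-density A C K bounded unbounded (mkℚ ℤ.-[1+ e ]   d _) (ℚ.*<* ())
half-density A C K bounded unbounded (mkℚ ℤ.+[1+ e ]   d _) _
  -- For ε = (e+1)/(d+1), a denominator above K (d+1) already brings the distance below 1/(d+1).
  with X , large ← unbounded (suc (K * suc d)) = X , close
  where
  close : ∀ x → X ≤ x → ℚ.∣ A x ÷ C x ℚ.- ½ ∣ ℚ.< mkℚ ℤ.+[1+ e ] d _
  close x X≤x = ℚ.toℚᵘ-cancel-< (÷-half-close (A x) (C x) d (suc e) (pred (C x))
    (≤-<-trans (*-monoˡ-≤ (suc d) (bounded x)) (large x X≤x))
    (sym (suc-pred (C x) {{>-nonZero (≤-<-trans z≤n (large x X≤x))}})))

unit-sign : ∀ s i → ∣ s ∣ ≡ 1 → 0ℤ <ℤ s ℤ.* i → (s ≡ 1ℤ × 0ℤ <ℤ i) ⊎ (s ≡ -1ℤ × i <ℤ 0ℤ)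
unit-sign s i ∣s∣≡1 0<si with ∣i∣≡1⇒i≡±1 s ∣s∣≡1
... | inj₁ refl = inj₁ (refl , subst (0ℤ <ℤ_) (ℤ.*-identityˡ i) 0<si)
... | inj₂ refl = inj₂ (refl , ℤ.neg-cancel-< (subst (0ℤ <ℤ_) (ℤ.-1*i≡-i i) 0<si))

-- Equidistribution of the two signs

module _ {N₁ N₂} .{{_ : NonZero N₁}} .{{_ : NonZero N₂}}
         (χ₁ : DirichletCharacter N₁) (χ₂ : DirichletCharacter N₂)
         (q₁ : Quadratic χ₁) (q₂ : Quadratic χ₂) where

  private
    M = N₁ * N₂
    instance
      M≢0 : NonZero M
      M≢0 = m*n≢0 N₁ N₂

    coprime-left : Coprime n M → Coprime n N₁
    coprime-left c (d∣n , d∣N₁) = c (d∣n , ∣m⇒∣m*n N₂ d∣N₁)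

    coprime-right : Coprime n M → Coprime n N₂
    coprime-right c (d∣n , d∣N₂) = c (d∣n , ∣n⇒∣m*n N₁ d∣N₂)

    -- χ₂ times the principal character mod N₁, a character mod N₁N₂ whose support
    -- is exactly the integers prime to N₁N₂.
    t : ℕ → ℤ
    t n = χℕ χ₁ n ℤ.* χℕ χ₁ n ℤ.* χℕ χ₂ n

    t-coprime : Coprime n N₁ → t n ≡ χℕ χ₂ n
    t-coprime {n} c = trans
      (cong (ℤ._* χℕ χ₂ n) (∣i∣≡1⇒i*i≡1 (χℕ χ₁ n) (χℕ-coprime χ₁ q₁ c))) (ℤ.*-identityˡ _)

    t-¬coprime : ¬ Coprime n M → t n ≡ 0ℤ
    t-¬coprime {n} ¬c with coprime? n N₁
    ... | no ¬c₁ rewrite χℕ-¬coprime χ₁ {n} ¬c₁ = refl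
    ... | yes c₁ = trans (t-coprime c₁) (χℕ-¬coprime χ₂ (λ c₂ → ¬c (coprime-* c₁ c₂)))

    t-* : Multiplicative t
    t-* a b rewrite χℕ-* χ₁ a b | χℕ-* χ₂ a b = arith (χℕ χ₁ a) (χℕ χ₁ b) (χℕ χ₂ a) (χℕ χ₂ b)
      where
      arith : ∀ x y z w → x ℤ.* y ℤ.* (x ℤ.* y) ℤ.* (z ℤ.* w) ≡ x ℤ.* x ℤ.* z ℤ.* (y ℤ.* y ℤ.* w)
      arith = ℤ.solve-∀

    t-periodic : Periodic M t
    t-periodic n = cong₂ (λ x y → x ℤ.* x ℤ.* y)
      (trans (cong (λ m → χℕ χ₁ (n + m)) (*-comm N₁ N₂)) (periodic-* (χℕ-periodic χ₁) n N₂))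
      (periodic-* (χℕ-periodic χ₂) n N₁)

    ∣t∣≤1 : ∀ n → ∣ t n ∣ ≤ 1
    ∣t∣≤1 n = begin
      ∣ t n ∣
        ≡⟨ ℤ.abs-* (χℕ χ₁ n ℤ.* χℕ χ₁ n) (χℕ χ₂ n) ⟩
      ∣ χℕ χ₁ n ℤ.* χℕ χ₁ n ∣ * ∣ χℕ χ₂ n ∣
        ≡⟨ cong (_* ∣ χℕ χ₂ n ∣) (ℤ.abs-* (χℕ χ₁ n) (χℕ χ₁ n)) ⟩
      ∣ χℕ χ₁ n ∣ * ∣ χℕ χ₁ n ∣ * ∣ χℕ χ₂ n ∣
        ≤⟨ *-mono-≤ (*-mono-≤ (∣χℕ∣≤1 χ₁ q₁ n) (∣χℕ∣≤1 χ₁ q₁ n)) (∣χℕ∣≤1 χ₂ q₂ n) ⟩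
      1 ∎
      where open ≤-Reasoning

    -- An argument with χ₂ = -1 may share a factor with `N₁`, where `t` vanishes; it is therefore
    -- chosen prime to `N₁` too.
    ∃-t≡-1 : ∃[ a ] Coprime a M × t a ≡ -1ℤ
    ∃-t≡-1 with a , a⊥N₁ , a⊥N₂ , χa≡-1 ← ∃-coprime-χℕ≡-1 χ₂ q₂ N₁ =
      a , coprime-* a⊥N₁ a⊥N₂ , trans (t-coprime a⊥N₁) χa≡-1

    partialSum-t≡0 : partialSum t M ≡ 0ℤ
    partialSum-t≡0 with a , a⊥M , ta≡-1 ← ∃-t≡-1 = orthogonality t-periodic t-* a⊥M ta≡-1

    1+kM-coprime : ∀ k → Coprime (suc (k * M)) M
    1+kM-coprime k {d} (d∣ , d∣M) =
      ∣1⇒≡1 (∣m+n∣m⇒∣n (subst (d ∣_) (+-comm 1 (k * M)) d∣) (∣n⇒∣m*n k d∣M))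

  -- The unit `c` lets one argument serve both signs: 1 for positive and -1 for negative values of
  -- `σ`. In the bound `M + 1`, `M` comes from the partial sums of `t` and 1 from the term at 0.
  character-density : {P : Pred ℕ ℓ} (P? : Decidable P) → ∀ c → ∣ c ∣ ≡ 1 →
    (∀ {n} → n ≢ 0 → Coprime n M → P n → c ℤ.* χℕ χ₂ n ≡ 1ℤ) →
    (∀ {n} → n ≢ 0 → Coprime n M → ¬ P n → c ℤ.* χℕ χ₂ n ≡ -1ℤ) →
    HasDensity (λ n → coprime? n M) P? ½
  character-density P? c ∣c∣≡1 pos neg =
    half-density (count (Q? ∩? P?)) (count Q?) (M + 1) bounded unbounded
    where
    Q? : Decidable (λ n → Coprime n M)
    Q? n = coprime? n M
    ct : ℕ → ℤ
    ct n = c ℤ.* t n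
    bias : ℕ → ℤ
    bias x = + 2 ℤ.* + count (Q? ∩? P?) x ℤ.- + count Q? x
    ct-coprime : Coprime n M → ct n ≡ c ℤ.* χℕ χ₂ n
    ct-coprime n⊥M = cong (c ℤ.*_) (t-coprime (coprime-left n⊥M))
    bias≡ : ∀ x → bias x ≡ partialSum ct (suc x) ℤ.- ct 0
    bias≡ x = trans (arith (ct 0) (bias x)) (cong (ℤ._- ct 0) (sym (count-bias Q? P? {ct}
      (λ n≢0 n⊥M Pn → trans (ct-coprime n⊥M) (pos n≢0 n⊥M Pn))
      (λ n≢0 n⊥M ¬Pn → trans (ct-coprime n⊥M) (neg n≢0 n⊥M ¬Pn))
      (λ ¬n⊥M → trans (cong (c ℤ.*_) (t-¬coprime ¬n⊥M)) (ℤ.*-zeroʳ c)) x)))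
      where
      arith : ∀ u b → b ≡ u ℤ.+ b ℤ.- u
      arith = ℤ.solve-∀
    ∣c*_∣ : ∀ i → ∣ c ℤ.* i ∣ ≡ ∣ i ∣
    ∣c* i ∣ = trans (ℤ.abs-* c i) (trans (cong (_* ∣ i ∣) ∣c∣≡1) (*-identityˡ ∣ i ∣))
    bounded : ∀ x → ∣ bias x ∣ ≤ M + 1
    bounded x = begin
      ∣ bias x ∣
        ≡⟨ cong ∣_∣ (bias≡ x) ⟩
      ∣ partialSum ct (suc x) ℤ.- ct 0 ∣
        ≤⟨ ℤ.∣i-j∣≤∣i∣+∣j∣ (partialSum ct (suc x)) (ct 0) ⟩
      ∣ partialSum ct (suc x) ∣ + ∣ ct 0 ∣
        ≡⟨ cong (λ S → ∣ S ∣ + ∣ ct 0 ∣) (sumℤ-map-*ˡ c t (upTo (suc x))) ⟩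
      ∣ c ℤ.* partialSum t (suc x) ∣ + ∣ c ℤ.* t 0 ∣
        ≡⟨ cong₂ _+_ ∣c* partialSum t (suc x) ∣ ∣c* t 0 ∣ ⟩
      ∣ partialSum t (suc x) ∣ + ∣ t 0 ∣
        ≤⟨ +-mono-≤ (partialSum-bounded t-periodic partialSum-t≡0 ∣t∣≤1 (suc x)) (∣t∣≤1 0) ⟩
      M + 1 ∎
      where open ≤-Reasoning
    unbounded : ∀ m → ∃[ X ] (∀ x → X ≤ x → m ≤ count Q? x)
    unbounded m = m * M , λ x mM≤x →
      ≤-trans (count-progression Q? 1+kM-coprime m) (count-mono-≤ Q? mM≤x)

  -- Along a + jM neither coprimality to `M` nor χ₂ changes, and j = m + 1 takes the value beyond
  -- `m`. Infinitude thus comes without densities.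
  infinitelyMany-χ≡ : ∀ {a} → Coprime a M →
                     InfinitelyMany (λ n → n ≢ 0 × Coprime n M × χℕ χ₂ n ≡ χℕ χ₂ a)
  infinitelyMany-χ≡ {a} a⊥M m = n₀ , m<n₀ , m<n⇒n≢0 m<n₀ , n₀⊥M , χn₀≡χa
    where
    n₀ = a + suc m * M
    m<n₀ : m < n₀
    m<n₀ = ≤-trans (m≤m*n (suc m) M) (m≤n+m (suc m * M) a)
    n₀⊥M : Coprime n₀ M
    n₀⊥M {d} (d∣n₀ , d∣M) =
      a⊥M (∣m+n∣m⇒∣n (subst (d ∣_) (+-comm a (suc m * M)) d∣n₀) (∣n⇒∣m*n (suc m) d∣M) , d∣M)
    χn₀≡χa : χℕ χ₂ n₀ ≡ χℕ χ₂ a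
    χn₀≡χa = trans (sym (t-coprime (coprime-left n₀⊥M)))
      (trans (periodic-* t-periodic a (suc m)) (t-coprime (coprime-left a⊥M)))

  module _ (k : ℕ) where

    private
      s : ℕ → ℤ
      s = σ χ₁ χ₂ (suc k)

    -- The two cases exclude each other, so the value of χ₂ and the sign of `σ` determine one
    -- another; in particular `σ` is never 0 here.
    σ-sign-cases : n ≢ 0 → Coprime n M → (χℕ χ₂ n ≡ 1ℤ × 0ℤ <ℤ s n) ⊎ (χℕ χ₂ n ≡ -1ℤ × s n <ℤ 0ℤ)
    σ-sign-cases {n} n≢0 n⊥M = unit-sign (χℕ χ₂ n) (s n) (χℕ-coprime χ₂ q₂ (coprime-right n⊥M))
      (σ-sign χ₁ χ₂ q₁ q₂ k n≢0 (coprime-left n⊥M) (coprime-right n⊥M))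

    infinitelyMany-σ>0 : InfinitelyMany (λ n → 0ℤ <ℤ s n)
    infinitelyMany-σ>0 m with infinitelyMany-χ≡ (Coprimality.1-coprimeTo M) m
    ... | n , m<n , n≢0 , n⊥M , χn≡χ1 with σ-sign-cases n≢0 n⊥M
    ...   | inj₁ (_ , 0<σ)   = n , m<n , 0<σ
    ...   | inj₂ (χn≡-1 , _) with () ← trans (sym χn≡-1) (trans χn≡χ1 (χℕ-1 χ₂))

    infinitelyMany-σ<0 : InfinitelyMany (λ n → s n <ℤ 0ℤ)
    infinitelyMany-σ<0 m with a , a⊥M , ta≡-1 ← ∃-t≡-1 with infinitelyMany-χ≡ a⊥M m
    ... | n , m<n , n≢0 , n⊥M , χn≡χa with σ-sign-cases n≢0 n⊥M
    ...   | inj₂ (_ , σ<0)  = n , m<n , σ<0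
    ...   | inj₁ (χn≡1 , _)
      with () ← trans (sym χn≡1) (trans χn≡χa (trans (sym (t-coprime (coprime-left a⊥M))) ta≡-1))

    density-σ>0 : HasDensity (λ n → coprime? n M) (λ n → 0ℤ ℤ.<? s n) ½
    density-σ>0 = character-density (λ n → 0ℤ ℤ.<? s n) 1ℤ refl
      (λ n≢0 n⊥M 0<σ → trans (ℤ.*-identityˡ _)
        ([ proj₁ , (λ (_ , σ<0) → contradiction σ<0 (ℤ.<-asym 0<σ)) ]′ (σ-sign-cases n≢0 n⊥M)))
      -- Failing to be positive forces χ₂(n) = -1, because the dichotomy leaves no room for the
      -- value 0.
      (λ n≢0 n⊥M 0≮σ → trans (ℤ.*-identityˡ _)
        ([ (λ (_ , 0<σ) → contradiction 0<σ 0≮σ) , proj₁ ]′ (σ-sign-cases n≢0 n⊥M)))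

    density-σ<0 : HasDensity (λ n → coprime? n M) (λ n → s n ℤ.<? 0ℤ) ½
    density-σ<0 = character-density (λ n → s n ℤ.<? 0ℤ) -1ℤ refl
      (λ n≢0 n⊥M σ<0 → cong (-1ℤ ℤ.*_)
        ([ (λ (_ , 0<σ) → contradiction σ<0 (ℤ.<-asym 0<σ)) , proj₁ ]′ (σ-sign-cases n≢0 n⊥M)))
      (λ n≢0 n⊥M σ≮0 → cong (-1ℤ ℤ.*_)
        ([ proj₁ , (λ (_ , σ<0) → contradiction σ<0 σ≮0) ]′ (σ-sign-cases n≢0 n⊥M)))

corollary3p2 : (N₁ N₂ : ℕ) .{{_ : NonZero N₁}} .{{_ : NonZero N₂}} →
    (k : ℕ) → 2 ≤ k →
    (χ₁ : DirichletCharacter N₁) (χ₂ : DirichletCharacter N₂) →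
    Quadratic χ₁ → Quadratic χ₂ →
    InfinitelyMany (λ n → 0ℤ <ℤ σ χ₁ χ₂ (k ∸ 1) n)
    × InfinitelyMany (λ n → σ χ₁ χ₂ (k ∸ 1) n <ℤ 0ℤ)
    × HasDensity (λ n → coprime? n (N₁ * N₂)) (λ n → 0ℤ <ℤ? σ χ₁ χ₂ (k ∸ 1) n) ½
    × HasDensity (λ n → coprime? n (N₁ * N₂)) (λ n → σ χ₁ χ₂ (k ∸ 1) n <ℤ? 0ℤ) ½
-- Matching on 2 ≤ k makes `k ∸ 1` compute to a successor, the positive exponent that the sign
-- argument works with.
corollary3p2 N₁ N₂ (suc (suc k)) (s≤s (s≤s z≤n)) χ₁ χ₂ q₁ q₂ =
  infinitelyMany-σ>0 χ₁ χ₂ q₁ q₂ k , infinitelyMany-σ<0 χ₁ χ₂ q₁ q₂ k ,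
  density-σ>0 χ₁ χ₂ q₁ q₂ k , density-σ<0 χ₁ χ₂ q₁ q₂ k
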